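{- Let $G$ be a finite group. Then $G$ is an elementary abelian $3$-group if and only if all of the following hold: (a) for every maximal subgroup $M$ of $G$, the non-trivial cosets of $M$ in $G$ are exactly two sets, and each of them is a maximal sum-free set in $G$; (b) every maximal sum-free set in $G$ is a non-trivial coset of some maximal subgroup of $G$; (c) $\Phi(G)=1$, where $\Phi(G)$ denotes the Frattini subgroup of $G$ (the intersection of all maximal subgroups of $G$).
   Context: A non-empty subset $S$ of a group $G$ is called sum-free if for all $s_1,s_2\in S$ (including the case $s_1=s_2$) one has $s_1s_2\notin S$. A maximal sum-free set in a finite group $G$ means a sum-free set of largest possible cardinality among all sum-free sets in $G$ (maximal by cardinality). A non-trivial coset of a subgroup $H$ is a coset $gH$ with $g\notin H$. -}

module Defs where

open import Algebra.Bundles using (Group)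
import Algebra.Definitions.RawMonoid as RawMonoidDefinitions
open import Data.Fin.Base using (Fin)
open import Data.Fin.Subset as Subset using (Subset; ⊤; _⊂_; ∣_∣)
open import Data.Nat.Base using (ℕ; _≤_; _<_)
open import Data.Product.Base using (_×_; ∃)
open import Function.Bundles using (Inverse; _⇔_)
open import Level using (_⊔_; suc)
open import Relation.Binary.PropositionalEquality as ≡ using (_≡_; _≢_)
open import Relation.Nullary.Negation using (¬_)
open import Relation.Unary using (Pred)

record FiniteGroup c ℓ : Set (suc (c ⊔ ℓ)) where
  field
    group       : Group c ℓ
    size        : ℕ
    enumeration : Inverse (Group.setoid group) (≡.setoid (Fin size))

  open Group group public
  open Inverse enumeration public using () renaming (to to index)

module FiniteGroupTheory {c ℓ} (G : FiniteGroup c ℓ) where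

  open FiniteGroup G
  open RawMonoidDefinitions rawMonoid using () renaming (_×_ to power)

  -- Subsets of G are subsets of the index set Fin size. They respect _≈_,
  -- propositional equality of them is extensional, and ∣_∣ is the cardinality.

  SubsetOf : Set
  SubsetOf = Subset size

  infix 4 _∈_ _∉_

  _∈_ : Carrier → SubsetOf → Set
  x ∈ S = index x Subset.∈ S

  _∉_ : Carrier → SubsetOf → Set
  x ∉ S = ¬ (x ∈ S)

  record HasOrder (x : Carrier) (k : ℕ) : Set ℓ where
    field
      positive : 0 < k
      power≈ε  : power k x ≈ ε
      least    : ∀ j → 0 < j → power j x ≈ ε → k ≤ j

  -- For prime p. The trivial group (rank 0) is included.
  record IsElementaryAbelian (p : ℕ) : Set (c ⊔ ℓ) where
    field
      comm    : ∀ x y → x ∙ y ≈ y ∙ x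
      order-p : ∀ x → x ≉ ε → HasOrder x p

  record IsSubgroup (H : SubsetOf) : Set c where
    field
      ε-closed  : ε ∈ H
      ∙-closed  : ∀ {x y} → x ∈ H → y ∈ H → x ∙ y ∈ H
      ⁻¹-closed : ∀ {x} → x ∈ H → x ⁻¹ ∈ H

  record IsMaximalSubgroup (M : SubsetOf) : Set c where
    field
      isSubgroup : IsSubgroup M
      proper     : M ≢ ⊤
      maximal    : ∀ H → IsSubgroup H → M ⊂ H → H ≡ ⊤

  -- S = g H
  IsCoset : Carrier → SubsetOf → SubsetOf → Set (c ⊔ ℓ)
  IsCoset g H S = ∀ x → x ∈ S ⇔ (∃ λ h → h ∈ H × x ≈ g ∙ h)

  IsNonTrivialCoset : SubsetOf → SubsetOf → Set (c ⊔ ℓ)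
  IsNonTrivialCoset H S = ∃ λ g → g ∉ H × IsCoset g H S

  record IsSumFree (S : SubsetOf) : Set c where
    field
      nonempty : ∃ λ s → s ∈ S
      sumFree  : ∀ {s₁ s₂} → s₁ ∈ S → s₂ ∈ S → s₁ ∙ s₂ ∉ S

  -- Maximal by cardinality, not by inclusion.
  record IsMaximalSumFree (S : SubsetOf) : Set c where
    field
      isSumFree : IsSumFree S
      largest   : ∀ T → IsSumFree T → ∣ T ∣ ≤ ∣ S ∣

  -- All of G when there are no maximal subgroups.
  Φ : Pred Carrier c
  Φ x = ∀ M → IsMaximalSubgroup M → x ∈ M

{-# OPTIONS --safe #-}

-- In an elementary abelian 3-group, a sum-free S ∋ s is disjoint from Ss and Ss², so 3∣S∣ ≤ ∣G∣,
-- and the bound is attained by the non-trivial cosets of a complement of ⟨ x ⟩, for any x ≠ 1;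
-- the complements of the subgroups of order 3 are exactly the maximal subgroups. If S attains
-- the bound then S, Ss, Ss² partition G for every s ∈ S, which forces S to be an affine subspace.
--
-- Conversely, if every maximal subgroup M has exactly two non-trivial cosets, G acts on the three
-- cosets of M. The elements acting by rotations form a subgroup which, were it proper, would be
-- maximal of index 2. Hence G acts on G/M through the cyclic group of order 3, so all cubes and
-- commutators lie in M for every M, hence in Φ(G) = 1.
module Submission where

open import Defs
open import Algebra.Bundles using (CommutativeMonoid)
import Algebra.Definitions.RawMonoid as RawMonoidDefinitions
import Algebra.Properties.CommutativeMonoid.Sum as CommutativeMonoidSum
import Algebra.Properties.Group as GroupProperties
import Algebra.Properties.Monoid.Mult as MonoidMult
import Algebra.Solver.CommutativeMonoid as CommutativeMonoidSolver
open import Data.Bool.Base using (if_then_else_)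
open import Data.Fin.Base using (Fin; zero; suc)
open import Data.Fin.Patterns using (0F; 1F; 2F)
open import Data.Fin.Permutation using (Permutation′; permutation)
open import Data.Fin.Properties using (_≟_; all?; any?)
open import Data.Fin.Subset as Subset using (Subset; ⊤; inside; outside; _⊂_; _⊃_; ∣_∣)
open import Data.Fin.Subset.Induction using (⊃-wellFounded)
open import Data.Fin.Subset.Properties using (_∈?_; ⊆-antisym; ∈⊤)
open import Data.Nat.Base as ℕ using (ℕ; _≤_; _<_; z≤n; s≤s)
import Data.Nat.Properties as ℕ
open import Data.Product.Base using (_×_; ∃; ∃₂; _,_; proj₁; proj₂)
open import Data.Sum.Base as Sum using (_⊎_; inj₁; inj₂)
open import Data.Vec.Base using (tabulate; []; _∷_)
open import Data.Vec.Properties using (lookup∘tabulate; lookup⇒[]=; []=⇒lookup)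
open import Function.Base using (_∘_; id)
open import Function.Bundles using (_⇔_; mk⇔; Equivalence; Inverse)
open import Function.Definitions using (Injective)
open import Induction.WellFounded using (Acc; acc)
open import Level using (0ℓ; _⊔_)
open import Relation.Binary.PropositionalEquality as ≡ using (_≡_; _≢_; _≗_)
import Relation.Binary.Reasoning.Setoid as SetoidReasoning
open import Relation.Nullary.Decidable using
  (Dec; yes; no; does; dec-true; from-yes; map′; ¬?; _×-dec_; _⊎-dec_; _→-dec_)
open import Relation.Nullary.Negation using (¬_; contradiction)
open import Relation.Unary using (Pred; Decidable; _≐_)

open CommutativeMonoidSum ℕ.+-0-commutativeMonoid using (sum; ∑-distrib-+; sum-permute)

-- Sums and counting over finite index sets.

sum-mono-≤ : ∀ {n} {f g : Fin n → ℕ} → (∀ i → f i ≤ g i) → sum f ≤ sum g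
sum-mono-≤ {ℕ.zero}  f≤g = z≤n
sum-mono-≤ {ℕ.suc n} f≤g = ℕ.+-mono-≤ (f≤g zero) (sum-mono-≤ (f≤g ∘ suc))

sum-mono-< : ∀ {n} {f g : Fin n → ℕ} → (∀ i → f i ≤ g i) → ∀ i → f i < g i → sum f < sum g
sum-mono-< f≤g zero    fi<gi = ℕ.+-mono-<-≤ fi<gi (sum-mono-≤ (f≤g ∘ suc))
sum-mono-< f≤g (suc i) fi<gi = ℕ.+-mono-≤-< (f≤g zero) (sum-mono-< (f≤g ∘ suc) i fi<gi)

sum-one : ∀ n → sum {n} (λ _ → 1) ≡ n
sum-one ℕ.zero    = ≡.refl
sum-one (ℕ.suc n) = ≡.cong ℕ.suc (sum-one n)

-- Going through `does` makes the values compute along the vector `S`, so that `sum-indicator` needs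
-- no case split on membership.
indicator : ∀ {n} → Subset n → Fin n → ℕ
indicator S i = if does (i ∈? S) then 1 else 0

sum-indicator : ∀ {n} (S : Subset n) → sum (indicator S) ≡ ∣ S ∣
sum-indicator []            = ≡.refl
sum-indicator (inside  ∷ S) = ≡.cong ℕ.suc (sum-indicator S)
sum-indicator (outside ∷ S) = sum-indicator S

indicators-≤1 : ∀ {n} (S : Subset n) i j k →
  ¬ (i Subset.∈ S × j Subset.∈ S) → ¬ (i Subset.∈ S × k Subset.∈ S) →
  ¬ (j Subset.∈ S × k Subset.∈ S) →
  indicator S i ℕ.+ (indicator S j ℕ.+ indicator S k) ≤ 1
indicators-≤1 S i j k ¬ij ¬ik ¬jk with i ∈? S | j ∈? S | k ∈? S
... | yes p | yes q | _     = contradiction (p , q) ¬ij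
... | yes p | no _  | yes r = contradiction (p , r) ¬ik
... | no _  | yes q | yes r = contradiction (q , r) ¬jk
... | yes _ | no _  | no _  = ℕ.≤-refl
... | no _  | yes _ | no _  = ℕ.≤-refl
... | no _  | no _  | yes _ = ℕ.≤-refl
... | no _  | no _  | no _  = z≤n

indicators-≥1 : ∀ {n} (S : Subset n) i j k →
  i Subset.∈ S ⊎ j Subset.∈ S ⊎ k Subset.∈ S →
  1 ≤ indicator S i ℕ.+ (indicator S j ℕ.+ indicator S k)
indicators-≥1 S i j k some with i ∈? S | j ∈? S | k ∈? S | some
... | yes _ | _     | _     | _                = s≤s z≤n
... | no _  | yes _ | _     | _                = s≤s z≤n
... | no _  | no _  | yes _ | _                = s≤s z≤n
... | no ¬p | no _  | no _  | inj₁ p           = contradiction p ¬p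
... | no _  | no ¬q | no _  | inj₂ (inj₁ q)    = contradiction q ¬q
... | no _  | no _  | no ¬r | inj₂ (inj₂ r)    = contradiction r ¬r

-- Permutations of three points.

next : Fin 3 → Fin 3
next 0F = 1F
next 1F = 2F
next 2F = 0F

-- The inverse 3-cycle, written as a square so that identities about `next` apply to it by
-- unfolding.
prev : Fin 3 → Fin 3
prev = next ∘ next

next-prev : next ∘ prev ≗ id
next-prev 0F = ≡.refl
next-prev 1F = ≡.refl
next-prev 2F = ≡.refl

-- Commuting with one 3-cycle characterises the powers of that cycle; as a pointwise equation it is
-- decidable and passes easily to composites.
Rotation : (Fin 3 → Fin 3) → Set
Rotation f = f ∘ next ≗ next ∘ f

Reflection : (Fin 3 → Fin 3) → Set
Reflection f = f ∘ next ≗ prev ∘ f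

rotation? : Decidable Rotation
rotation? f = all? λ i → f (next i) ≟ next (f i)

rotation-∘ : ∀ {f g} → Rotation f → Rotation g → Rotation (f ∘ g)
rotation-∘ {f} {g} rf rg i = ≡.trans (≡.cong f (rg i)) (rf (g i))

reflection-∘ : ∀ {f g} → Reflection f → Reflection g → Rotation (f ∘ g)
reflection-∘ {f} {g} rf rg i = begin
  f (g (next i))               ≡⟨ ≡.cong f (rg i) ⟩
  f (next (next (g i)))        ≡⟨ rf (next (g i)) ⟩
  prev (f (next (g i)))        ≡⟨ ≡.cong prev (rf (g i)) ⟩
  next (next (prev (f (g i)))) ≡⟨ ≡.cong next (next-prev (f (g i))) ⟩
  next (f (g i))               ∎
  where open ≡.≡-Reasoning

injective⇒rotation⊎reflection : ∀ {f : Fin 3 → Fin 3} → Injective _≡_ _≡_ f →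
                                Rotation f ⊎ Reflection f
injective⇒rotation⊎reflection {f} inj
  with distinct-triples (f 0F) (f 1F) (f 2F) (differ λ ()) (differ λ ()) (differ λ ())
  where
  distinct-triples : ∀ a b c → a ≢ b → a ≢ c → b ≢ c →
    (b ≡ next a × c ≡ next b × a ≡ next c) ⊎ (b ≡ prev a × c ≡ prev b × a ≡ prev c)
  -- Stated for the three values rather than for `f`, so that evaluating all 27 triples decides it.
  distinct-triples = from-yes (all? λ a → all? λ b → all? λ c →
    ¬? (a ≟ b) →-dec ¬? (a ≟ c) →-dec ¬? (b ≟ c) →-dec
    ((b ≟ next a ×-dec c ≟ next b ×-dec a ≟ next c) ⊎-dec
     (b ≟ prev a ×-dec c ≟ prev b ×-dec a ≟ prev c)))

  differ : ∀ {i j} → i ≢ j → f i ≢ f j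
  differ i≢j = i≢j ∘ inj
... | inj₁ (p , q , r) = inj₁ λ { 0F → p ; 1F → q ; 2F → r }
... | inj₂ (p , q , r) = inj₂ λ { 0F → p ; 1F → q ; 2F → r }

-- Commuting with the cycle propagates the value at `0F` to the other points, so one candidate
-- remains for each such value.
rotation-cases : ∀ {f} → Rotation f → f ≗ id ⊎ f ≗ next ⊎ f ≗ prev
rotation-cases {f} rf = cases (f 0F) ≡.refl
  where
  determined : ∀ {g} → Rotation g → f 0F ≡ g 0F → f ≗ g
  determined rg eq 0F = eq
  determined rg eq 1F = ≡.trans (rf 0F) (≡.trans (≡.cong next eq) (≡.sym (rg 0F)))
  determined rg eq 2F = ≡.trans (rf 1F)
    (≡.trans (≡.cong next (determined rg eq 1F)) (≡.sym (rg 1F)))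

  cases : ∀ k → f 0F ≡ k → f ≗ id ⊎ f ≗ next ⊎ f ≗ prev
  cases 0F eq = inj₁ (determined (λ _ → ≡.refl) eq)
  cases 1F eq = inj₂ (inj₁ (determined (λ _ → ≡.refl) eq))
  cases 2F eq = inj₂ (inj₂ (determined (λ _ → ≡.refl) eq))

-- The rotation `f` is a power of `next`, and `g` commutes with `next`.
rotation-comm : ∀ {f g} → Rotation f → Rotation g → f ∘ g ≗ g ∘ f
rotation-comm {f} {g} rf rg i with rotation-cases rf
... | inj₁ f≗id          = ≡.trans (f≗id (g i)) (≡.cong g (≡.sym (f≗id i)))
... | inj₂ (inj₁ f≗next) = ≡.trans (f≗next (g i))
  (≡.trans (≡.sym (rg i)) (≡.cong g (≡.sym (f≗next i))))
... | inj₂ (inj₂ f≗prev) = ≡.trans (f≗prev (g i))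
  (≡.trans (≡.sym (≡.trans (rg (next i)) (≡.cong next (rg i)))) (≡.cong g (≡.sym (f≗prev i))))

rotation-cube : ∀ {f} → Rotation f → f ∘ f ∘ f ≗ id
rotation-cube {f} rf i with rotation-cases rf
... | inj₁ f≗id          = ≡.trans (f≗id _) (≡.trans (f≗id _) (f≗id i))
... | inj₂ (inj₁ f≗next) = ≡.trans (f≗next _)
  (≡.trans (≡.cong next (≡.trans (f≗next _) (≡.cong next (f≗next i)))) (next-prev i))
... | inj₂ (inj₂ f≗prev) = ≡.trans (f≗prev _)
  (≡.trans (≡.cong prev (≡.trans (f≗prev _) (≡.cong prev (f≗prev i))))
    (≡.trans (≡.cong next (next-prev (prev i))) (next-prev i)))

-- Finite groups: equality, membership and comprehension.

module FiniteGroupProperties {c ℓ} (G : FiniteGroup c ℓ) where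

  open FiniteGroup G
  open FiniteGroupTheory G
  open GroupProperties group using
    (\\-leftDividesˡ; \\-leftDividesʳ; ⁻¹-anti-homo-\\; ⁻¹-anti-homo-∙; ε⁻¹≈ε; ⁻¹-involutive)

  element : Fin size → Carrier
  element = Inverse.from enumeration

  index-element : ∀ i → index (element i) ≡ i
  index-element = Inverse.strictlyInverseˡ enumeration

  element-index : ∀ x → element (index x) ≈ x
  element-index = Inverse.strictlyInverseʳ enumeration

  index-cong : ∀ {x y} → x ≈ y → index x ≡ index y
  index-cong = Inverse.to-cong enumeration

  infix 4 _≈?_
  _≈?_ : ∀ x y → Dec (x ≈ y)
  x ≈? y = map′ index-injective index-cong (index x ≟ index y)
    where
    open SetoidReasoning setoid

    index-injective : ∀ {x y} → index x ≡ index y → x ≈ y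
    index-injective {x} {y} eq = begin
      x                 ≈⟨ element-index x ⟨
      element (index x) ≡⟨ ≡.cong element eq ⟩
      element (index y) ≈⟨ element-index y ⟩
      y                 ∎

  ∈-resp-≈ : ∀ {S x y} → x ≈ y → x ∈ S → y ∈ S
  ∈-resp-≈ {S} x≈y = ≡.subst (Subset._∈ S) (index-cong x≈y)

  element-∈ : ∀ {S i} → i Subset.∈ S → element i ∈ S
  element-∈ {S} {i} = ≡.subst (Subset._∈ S) (≡.sym (index-element i))

  element-∈⁻¹ : ∀ {S i} → element i ∈ S → i Subset.∈ S
  element-∈⁻¹ {S} {i} = ≡.subst (Subset._∈ S) (index-element i)

  subset-ext : ∀ {S T} → (∀ {x} → x ∈ S → x ∈ T) → (∀ {x} → x ∈ T → x ∈ S) → S ≡ T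
  subset-ext S⊆T T⊆S =
    ⊆-antisym (element-∈⁻¹ ∘ S⊆T ∘ element-∈) (element-∈⁻¹ ∘ T⊆S ∘ element-∈)

  all-∈⇒≡⊤ : ∀ {S} → (∀ x → x ∈ S) → S ≡ ⊤
  all-∈⇒≡⊤ all = subset-ext (λ _ → ∈⊤) (λ {x} _ → all x)

  ≡⊤⇒all-∈ : ∀ {S} → S ≡ ⊤ → ∀ x → x ∈ S
  ≡⊤⇒all-∈ ≡.refl x = ∈⊤

  ≢⊤⇒∃∉ : ∀ {S} → S ≢ ⊤ → ∃ λ x → x ∉ S
  ≢⊤⇒∃∉ {S} S≢⊤ with any? (λ i → ¬? (i ∈? S))
  ... | yes (i , i∉S) = element i , i∉S ∘ element-∈⁻¹
  ... | no none = contradiction (all-∈⇒≡⊤ all) S≢⊤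
    where
    all : ∀ x → x ∈ S
    all x with index x ∈? S
    ... | yes x∈S = x∈S
    ... | no x∉S  = contradiction (index x , x∉S) none

  ∉⇒⊂ : ∀ {S T x} → (∀ {y} → y ∈ S → y ∈ T) → x ∈ T → x ∉ S → S ⊂ T
  ∉⇒⊂ {x = x} S⊆T x∈T x∉S = element-∈⁻¹ ∘ S⊆T ∘ element-∈ , index x , x∈T , x∉S

  ⊂⇒⊆ : ∀ {S T x} → S ⊂ T → x ∈ S → x ∈ T
  ⊂⇒⊆ (S⊆T , _) = S⊆T

  ⊂⇒∃∉ : ∀ {S T} → S ⊂ T → ∃ λ x → x ∈ T × x ∉ S
  ⊂⇒∃∉ (_ , i , i∈T , i∉S) = element i , element-∈ i∈T , i∉S ∘ element-∈⁻¹

  -- `P` is tested only on the chosen representatives `element i`; this is why the membership lemmas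
  -- ask that `P` respect `_≈_`.
  comprehension : ∀ {p} {P : Pred Carrier p} → Decidable P → SubsetOf
  comprehension P? = tabulate (does ∘ P? ∘ element)

  module _ {p} {P : Pred Carrier p} (P? : Decidable P)
           (resp : ∀ {x y} → x ≈ y → P x → P y) where

    ∈-comprehension⁺ : ∀ {x} → P x → x ∈ comprehension P?
    ∈-comprehension⁺ {x} px = lookup⇒[]= (index x) (comprehension P?)
      (≡.trans (lookup∘tabulate _ (index x))
        (dec-true (P? (element (index x))) (resp (sym (element-index x)) px)))

    ∈-comprehension⁻ : ∀ {x} → x ∈ comprehension P? → P x
    ∈-comprehension⁻ {x} x∈ with P? (element (index x))
      | ≡.trans (≡.sym (lookup∘tabulate (does ∘ P? ∘ element) (index x))) ([]=⇒lookup x∈)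
    ... | yes px | _  = resp (element-index x) px
    ... | no _   | ()

  -- As a set this is `S g⁻¹`. When cubes are trivial, `translate S (g ∙ g)` is therefore `S g`.
  translate : SubsetOf → Carrier → SubsetOf
  translate S g = comprehension (λ x → index (x ∙ g) ∈? S)

  ∈-translate⁺ : ∀ {S g x} → x ∙ g ∈ S → x ∈ translate S g
  ∈-translate⁺ {S} {g} =
    ∈-comprehension⁺ (λ x → index (x ∙ g) ∈? S) (λ x≈y → ∈-resp-≈ (∙-congʳ x≈y))

  ∈-translate⁻ : ∀ {S g x} → x ∈ translate S g → x ∙ g ∈ S
  ∈-translate⁻ {S} {g} =
    ∈-comprehension⁻ (λ x → index (x ∙ g) ∈? S) (λ x≈y → ∈-resp-≈ (∙-congʳ x≈y))

  -- Counting with translates.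

  right-multiplication : Carrier → Permutation′ size
  right-multiplication g = permutation (shift g) (shift (g ⁻¹))
    (λ i → cancel g (g ⁻¹) (inverseˡ g) i) (λ i → cancel (g ⁻¹) g (inverseʳ g) i)
    where
    open SetoidReasoning setoid

    shift : Carrier → Fin size → Fin size
    shift g i = index (element i ∙ g)

    cancel : ∀ g h → h ∙ g ≈ ε → ∀ i → shift g (shift h i) ≡ i
    cancel g h hg≈ε i = ≡.trans (index-cong (begin
      element (index (element i ∙ h)) ∙ g ≈⟨ ∙-congʳ (element-index _) ⟩
      element i ∙ h ∙ g                   ≈⟨ assoc _ _ _ ⟩
      element i ∙ (h ∙ g)                 ≈⟨ ∙-congˡ hg≈ε ⟩
      element i ∙ ε                       ≈⟨ identityʳ _ ⟩
      element i                           ∎)) (index-element i)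

  shifted-indicator : SubsetOf → Carrier → Fin size → ℕ
  shifted-indicator S g i = indicator S (index (element i ∙ g))

  sum-shifted-indicator : ∀ S g → sum (shifted-indicator S g) ≡ ∣ S ∣
  sum-shifted-indicator S g = ≡.trans
    (≡.sym (sum-permute (indicator S) (right-multiplication g))) (sum-indicator S)

  -- At `x` this counts how many of `x`, `xg`, `xg²` lie in `S`; if `g` has order 3, it is the size
  -- of the intersection of `x⟨g⟩` with `S`.
  indicators : SubsetOf → Carrier → Fin size → ℕ
  indicators S g i =
    indicator S i ℕ.+ (shifted-indicator S g i ℕ.+ shifted-indicator S (g ∙ g) i)

  sum-indicators : ∀ S g → sum (indicators S g) ≡ 3 ℕ.* ∣ S ∣
  sum-indicators S g = begin
    sum (indicators S g)
      ≡⟨ ∑-distrib-+ (indicator S) (λ i → shifted-indicator S g i ℕ.+ shifted-indicator S (g ∙ g) i) ⟩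
    sum (indicator S) ℕ.+ sum (λ i → shifted-indicator S g i ℕ.+ shifted-indicator S (g ∙ g) i)
      ≡⟨ ≡.cong₂ ℕ._+_ (sum-indicator S)
           (∑-distrib-+ (shifted-indicator S g) (shifted-indicator S (g ∙ g))) ⟩
    ∣ S ∣ ℕ.+ (sum (shifted-indicator S g) ℕ.+ sum (shifted-indicator S (g ∙ g)))
      ≡⟨ ≡.cong (∣ S ∣ ℕ.+_) (≡.cong₂ ℕ._+_ (sum-shifted-indicator S g)
           (≡.trans (sum-shifted-indicator S (g ∙ g)) (≡.sym (ℕ.+-identityʳ ∣ S ∣)))) ⟩
    3 ℕ.* ∣ S ∣ ∎
    where open ≡.≡-Reasoning

  -- The union of `S`, `Sg⁻¹` and `Sg⁻²`. For a subgroup `S` of an elementary abelian 3-group it is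
  -- the subgroup generated by `S` and `g`, whence the name.
  Adjoined : SubsetOf → Carrier → Pred Carrier 0ℓ
  Adjoined S g x = x ∈ S ⊎ x ∙ g ∈ S ⊎ x ∙ (g ∙ g) ∈ S

  Covers : SubsetOf → Carrier → Set c
  Covers S g = ∀ x → Adjoined S g x

  -- Double counting: each point contributes at least 1 to a sum with value `3∣S∣`.
  covers⇒size≤3∣S∣ : ∀ {S g} → Covers S g → size ≤ 3 ℕ.* ∣ S ∣
  covers⇒size≤3∣S∣ {S} {g} cover = ≡.subst₂ _≤_ (sum-one size) (sum-indicators S g)
    (sum-mono-≤ (λ i → indicators-≥1 S i (index (element i ∙ g)) (index (element i ∙ (g ∙ g)))
      (Sum.map₁ element-∈⁻¹ (cover (element i)))))

  -- Left cosets of H are the classes of x ∼ y.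
  module LeftCosets {H : SubsetOf} (isSubgroup : IsSubgroup H) where

    open IsSubgroup isSubgroup

    infix 4 _∼_
    _∼_ : Carrier → Carrier → Set
    x ∼ y = x ⁻¹ ∙ y ∈ H

    ∼-reflexive : ∀ {x y} → x ≈ y → x ∼ y
    ∼-reflexive {x} x≈y = ∈-resp-≈ (trans (sym (inverseˡ x)) (∙-congˡ x≈y)) ε-closed

    ∼-sym : ∀ {x y} → x ∼ y → y ∼ x
    ∼-sym {x} {y} x∼y = ∈-resp-≈ (⁻¹-anti-homo-\\ x y) (⁻¹-closed x∼y)

    ∼-trans : ∀ {x y z} → x ∼ y → y ∼ z → x ∼ z
    ∼-trans {x} {y} {z} x∼y y∼z = ∈-resp-≈ (begin
      x ⁻¹ ∙ y ∙ (y ⁻¹ ∙ z)   ≈⟨ assoc _ _ _ ⟩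
      x ⁻¹ ∙ (y ∙ (y ⁻¹ ∙ z)) ≈⟨ ∙-congˡ (\\-leftDividesˡ y z) ⟩
      x ⁻¹ ∙ z                ∎) (∙-closed x∼y y∼z)
      where open SetoidReasoning setoid

    ∼-∙ˡ : ∀ g {x y} → x ∼ y → g ∙ x ∼ g ∙ y
    ∼-∙ˡ g {x} {y} = ∈-resp-≈ (sym (begin
      (g ∙ x) ⁻¹ ∙ (g ∙ y)      ≈⟨ ∙-congʳ (⁻¹-anti-homo-∙ g x) ⟩
      x ⁻¹ ∙ g ⁻¹ ∙ (g ∙ y)     ≈⟨ assoc _ _ _ ⟩
      x ⁻¹ ∙ (g ⁻¹ ∙ (g ∙ y))   ≈⟨ ∙-congˡ (\\-leftDividesʳ g y) ⟩
      x ⁻¹ ∙ y                  ∎))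
      where open SetoidReasoning setoid

    ∼-cancelˡ : ∀ g {x y} → g ∙ x ∼ g ∙ y → x ∼ y
    ∼-cancelˡ g {x} {y} gx∼gy = ∼-trans (∼-reflexive (sym (\\-leftDividesʳ g x)))
      (∼-trans (∼-∙ˡ (g ⁻¹) gx∼gy) (∼-reflexive (\\-leftDividesʳ g y)))

    ε∼⇒∈ : ∀ {x} → ε ∼ x → x ∈ H
    ε∼⇒∈ {x} = ∈-resp-≈ (trans (∙-congʳ ε⁻¹≈ε) (identityˡ x))

    ∈⇒ε∼ : ∀ {x} → x ∈ H → ε ∼ x
    ∈⇒ε∼ {x} = ∈-resp-≈ (sym (trans (∙-congʳ ε⁻¹≈ε) (identityˡ x)))

    coset⁺ : ∀ {g S x} → IsCoset g H S → g ∼ x → x ∈ S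
    coset⁺ {g} {x = x} coset g∼x =
      Equivalence.from (coset x) (g ⁻¹ ∙ x , g∼x , sym (\\-leftDividesˡ g x))

    coset⁻ : ∀ {g S x} → IsCoset g H S → x ∈ S → g ∼ x
    coset⁻ {g} {x = x} coset x∈S with Equivalence.to (coset x) x∈S
    ... | h , h∈H , x≈gh =
      ∈-resp-≈ (sym (trans (∙-congˡ x≈gh) (\\-leftDividesʳ g h))) h∈H

    coset-unique : ∀ {g h S T} → IsCoset g H S → IsCoset h H T → g ∼ h → S ≡ T
    coset-unique cosetS cosetT g∼h = subset-ext
      (λ x∈S → coset⁺ cosetT (∼-trans (∼-sym g∼h) (coset⁻ cosetS x∈S)))
      (λ x∈T → coset⁺ cosetS (∼-trans g∼h (coset⁻ cosetT x∈T)))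

    leftCoset? : ∀ g → Decidable (g ∼_)
    leftCoset? g x = index (g ⁻¹ ∙ x) ∈? H

    leftCoset : Carrier → SubsetOf
    leftCoset g = comprehension (leftCoset? g)

    leftCoset-isCoset : ∀ g → IsCoset g H (leftCoset g)
    leftCoset-isCoset g x = mk⇔
      (λ x∈ → g ⁻¹ ∙ x , ∈-comprehension⁻ (leftCoset? g) resp x∈ , sym (\\-leftDividesˡ g x))
      (λ { (h , h∈H , x≈gh) → ∈-comprehension⁺ (leftCoset? g) resp
        (∈-resp-≈ (sym (trans (∙-congˡ x≈gh) (\\-leftDividesʳ g h))) h∈H) })
      where
      resp : ∀ {x y} → x ≈ y → g ∼ x → g ∼ y
      resp x≈y = ∈-resp-≈ (∙-congˡ x≈y)

  -- The action on three left cosets.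

  open RawMonoidDefinitions rawMonoid using () renaming (_×_ to power)

  -- The parameters number the left cosets of `H` by `Fin 3`: `rep` chooses an element of each, and
  -- `label` finds the coset of a given element. Thus `H` has index 3.
  module CosetAction {H : SubsetOf} (isSubgroup : IsSubgroup H)
    (rep : Fin 3 → Carrier) (label : Carrier → Fin 3)
    (rep-label : ∀ x → LeftCosets._∼_ isSubgroup (rep (label x)) x)
    (rep-injective : ∀ {i j} → LeftCosets._∼_ isSubgroup (rep i) (rep j) → i ≡ j)
    where

    open LeftCosets isSubgroup

    label-cong : ∀ {x y} → x ∼ y → label x ≡ label y
    label-cong {x} {y} x∼y =
      rep-injective (∼-trans (rep-label x) (∼-trans x∼y (∼-sym (rep-label y))))

    label-injective : ∀ {x y} → label x ≡ label y → x ∼ y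
    label-injective {x} {y} eq =
      ∼-trans (∼-sym (rep-label x)) (≡.subst (λ i → rep i ∼ y) (≡.sym eq) (rep-label y))

    act : Carrier → Fin 3 → Fin 3
    act g i = label (g ∙ rep i)

    label-∙ : ∀ g x → label (g ∙ x) ≡ act g (label x)
    label-∙ g x = label-cong (∼-∙ˡ g (∼-sym (rep-label x)))

    act-cong : ∀ {g h} → g ≈ h → act g ≗ act h
    act-cong g≈h i = label-cong (∼-reflexive (∙-congʳ g≈h))

    act-ε : act ε ≗ id
    act-ε i = rep-injective (∼-trans (rep-label _) (∼-reflexive (identityˡ (rep i))))

    act-∙ : ∀ g h → act (g ∙ h) ≗ act g ∘ act h
    act-∙ g h i = ≡.trans (label-cong (∼-reflexive (assoc g h (rep i)))) (label-∙ g (h ∙ rep i))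

    act-injective : ∀ g → Injective _≡_ _≡_ (act g)
    act-injective g eq = rep-injective (∼-cancelˡ g (label-injective eq))

    act-inverseʳ : ∀ g → act g ∘ act (g ⁻¹) ≗ id
    act-inverseʳ g i = ≡.trans (≡.sym (act-∙ g (g ⁻¹) i))
      (≡.trans (act-cong (inverseʳ g) i) (act-ε i))

    -- The preimage of the alternating group of degree 3 under the action.
    Even : Pred Carrier _
    Even g = Rotation (act g)

    even? : Decidable Even
    even? g = rotation? (act g)

    even-resp-≈ : ∀ {g h} → g ≈ h → Even g → Even h
    even-resp-≈ g≈h eg i = ≡.trans (act-cong (sym g≈h) _)
      (≡.trans (eg i) (≡.cong next (act-cong g≈h i)))

    even-ε : Even ε
    even-ε i = ≡.trans (act-ε _) (≡.cong next (≡.sym (act-ε i)))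

    rotation⇒even-∙ : ∀ {g h} → Rotation (act g ∘ act h) → Even (g ∙ h)
    rotation⇒even-∙ {g} {h} rot i = ≡.trans (act-∙ g h _)
      (≡.trans (rot i) (≡.cong next (≡.sym (act-∙ g h i))))

    even-∙ : ∀ {g h} → Even g → Even h → Even (g ∙ h)
    even-∙ eg eh = rotation⇒even-∙ (rotation-∘ eg eh)

    even-⁻¹ : ∀ {g} → Even g → Even (g ⁻¹)
    even-⁻¹ {g} eg i = act-injective g (begin
      act g (act (g ⁻¹) (next i)) ≡⟨ act-inverseʳ g (next i) ⟩
      next i                      ≡⟨ ≡.cong next (act-inverseʳ g i) ⟨
      next (act g (act (g ⁻¹) i)) ≡⟨ eg (act (g ⁻¹) i) ⟨
      act g (next (act (g ⁻¹) i)) ∎)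
      where open ≡.≡-Reasoning

    odd⇒reflection : ∀ {g} → ¬ Even g → Reflection (act g)
    odd⇒reflection {g} ¬eg with injective⇒rotation⊎reflection (act-injective g)
    ... | inj₁ rot = contradiction rot ¬eg
    ... | inj₂ ref = ref

    odd-∙ : ∀ {g h} → ¬ Even g → ¬ Even h → Even (g ∙ h)
    odd-∙ ¬eg ¬eh = rotation⇒even-∙ (reflection-∘ (odd⇒reflection ¬eg) (odd⇒reflection ¬eh))

    evens : SubsetOf
    evens = comprehension even?

    ∈-evens⁺ : ∀ {g} → Even g → g ∈ evens
    ∈-evens⁺ = ∈-comprehension⁺ even? even-resp-≈

    ∈-evens⁻ : ∀ {g} → g ∈ evens → Even g
    ∈-evens⁻ = ∈-comprehension⁻ even? even-resp-≈

    evens-isSubgroup : IsSubgroup evens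
    evens-isSubgroup = record
      { ε-closed  = ∈-evens⁺ even-ε
      ; ∙-closed  = λ g∈ h∈ → ∈-evens⁺ (even-∙ (∈-evens⁻ g∈) (∈-evens⁻ h∈))
      ; ⁻¹-closed = λ g∈ → ∈-evens⁺ (even-⁻¹ (∈-evens⁻ g∈))
      }

    -- Two reflections compose to a rotation, so the elements outside `evens` share one left coset:
    -- the index is at most 2, in the form that `no-index-2` expects.
    odd-∼ : ∀ {g h} → g ∉ evens → h ∉ evens → g ⁻¹ ∙ h ∈ evens
    odd-∼ {g} g∉ h∉ = ∈-evens⁺ (odd-∙
      -- If `g⁻¹` were even, so would be its inverse `g`.
      (λ e → g∉ (∈-evens⁺ (even-resp-≈ (⁻¹-involutive g) (even-⁻¹ e)))) (h∉ ∘ ∈-evens⁺))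

    -- A rotation of three points has trivial cube, so `x³` fixes the coset `H`, that is, `x³` lies
    -- in `H`.
    label³ : ∀ x → Even x → label (power 3 x) ≡ label ε
    label³ x ex = begin
      label (x ∙ (x ∙ (x ∙ ε)))           ≡⟨ label-∙ x _ ⟩
      act x (label (x ∙ (x ∙ ε)))         ≡⟨ ≡.cong (act x) (label-∙ x _) ⟩
      act x (act x (label (x ∙ ε)))       ≡⟨ ≡.cong (act x ∘ act x) (label-∙ x ε) ⟩
      act x (act x (act x (label ε)))     ≡⟨ rotation-cube ex (label ε) ⟩
      label ε                             ∎
      where open ≡.≡-Reasoning

    label-comm : ∀ x y → Even x → Even y → label (x ∙ y) ≡ label (y ∙ x)
    label-comm x y ex ey = begin
      label (x ∙ y)           ≡⟨ expand x y ⟩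
      act x (act y (label ε)) ≡⟨ rotation-comm ex ey (label ε) ⟩
      act y (act x (label ε)) ≡⟨ expand y x ⟨
      label (y ∙ x)           ∎
      where
      open ≡.≡-Reasoning
      expand : ∀ x y → label (x ∙ y) ≡ act x (act y (label ε))
      expand x y = ≡.trans (label-∙ x y) (≡.cong (act x)
        (≡.trans (label-cong (∼-reflexive (sym (identityʳ y)))) (label-∙ y ε)))

  -- From two non-trivial cosets to an elementary abelian group.

  TwoNonTrivialCosets : SubsetOf → Set (c ⊔ ℓ)
  TwoNonTrivialCosets M =
    ∃₂ λ A B → A ≢ B × (∀ S → IsNonTrivialCoset M S ⇔ (S ≡ A ⊎ S ≡ B))

  module Converse (two : ∀ M → IsMaximalSubgroup M → TwoNonTrivialCosets M) where

    -- A proper subgroup of index 2 would be maximal with a single non-trivial coset.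
    no-index-2 : ∀ {K} → IsSubgroup K → (∀ {x y} → x ∉ K → y ∉ K → x ⁻¹ ∙ y ∈ K) →
                 ∀ x → x ∈ K
    no-index-2 {K} isSubgroup index-2 x with index x ∈? K
    ... | yes x∈K = x∈K
    ... | no x∉K
      with two K (record
        { isSubgroup = isSubgroup
        ; proper     = λ K≡⊤ → x∉K (≡⊤⇒all-∈ K≡⊤ x)
        ; maximal    = maximal
        })
      where
      maximal : ∀ L → IsSubgroup L → K ⊂ L → L ≡ ⊤
      maximal L L-isSubgroup K⊂L with ⊂⇒∃∉ K⊂L
      ... | h , h∈L , h∉K = all-∈⇒≡⊤ all
        where
        all : ∀ y → y ∈ L
        all y with index y ∈? K
        ... | yes y∈K = ⊂⇒⊆ K⊂L y∈K
        -- Write `y = h(h⁻¹y)`: both `h` and `y` are outside `K`, so `h⁻¹y` lies in `K`, hence in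
        -- `L`.
        ... | no y∉K  = ∈-resp-≈ (\\-leftDividesˡ h y)
          (IsSubgroup.∙-closed L-isSubgroup h∈L (⊂⇒⊆ K⊂L (index-2 h∉K y∉K)))
    ... | A , B , A≢B , cosets
      with Equivalence.from (cosets A) (inj₁ ≡.refl) | Equivalence.from (cosets B) (inj₂ ≡.refl)
    ... | a , a∉K , cosetA | b , b∉K , cosetB =
      contradiction (coset-unique cosetA cosetB (index-2 a∉K b∉K)) A≢B
      where open LeftCosets isSubgroup

    module _ {M} (M-max : IsMaximalSubgroup M) where

      open IsMaximalSubgroup M-max using (isSubgroup)
      open LeftCosets isSubgroup

      -- The cosets `M`, `aM`, `bM` make up `G`, so `G` acts on `Fin 3`. All elements act as
      -- rotations, since otherwise `evens` would have index 2; and rotations commute and have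
      -- trivial cube.
      maximal⇒abelian-exponent-3-quotient :
        (∀ x → power 3 x ∈ M) × (∀ x y → (x ∙ y) ⁻¹ ∙ (y ∙ x) ∈ M)
      maximal⇒abelian-exponent-3-quotient with two M M-max
      ... | A , B , A≢B , cosets
        with Equivalence.from (cosets A) (inj₁ ≡.refl) | Equivalence.from (cosets B) (inj₂ ≡.refl)
      ... | a , a∉M , cosetA | b , b∉M , cosetB =
        (λ x → ε∼⇒∈ (∼-sym (label-injective (label³ x (even x))))) ,
        (λ x y → label-injective (label-comm x y (even x) (even y)))
        where
        rep : Fin 3 → Carrier
        rep 0F = ε
        rep 1F = a
        rep 2F = b

        covered : ∀ x → ∃ λ i → rep i ∼ x
        covered x with index x ∈? M
        ... | yes x∈M = 0F , ∈⇒ε∼ x∈M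
        -- The coset `xM` is non-trivial, hence it is `A` or `B`.
        ... | no x∉M with Equivalence.to (cosets (leftCoset x)) (x , x∉M , leftCoset-isCoset x)
        ... | inj₁ xM≡A = 1F , coset⁻ cosetA
          (≡.subst (x ∈_) xM≡A (coset⁺ (leftCoset-isCoset x) (∼-reflexive refl)))
        ... | inj₂ xM≡B = 2F , coset⁻ cosetB
          (≡.subst (x ∈_) xM≡B (coset⁺ (leftCoset-isCoset x) (∼-reflexive refl)))

        a≁b : ¬ a ∼ b
        a≁b a∼b = A≢B (coset-unique cosetA cosetB a∼b)

        rep-injective : ∀ {i j} → rep i ∼ rep j → i ≡ j
        rep-injective {0F} {0F} _ = ≡.refl
        rep-injective {0F} {1F} p = contradiction (ε∼⇒∈ p) a∉M
        rep-injective {0F} {2F} p = contradiction (ε∼⇒∈ p) b∉M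
        rep-injective {1F} {0F} p = contradiction (ε∼⇒∈ (∼-sym p)) a∉M
        rep-injective {1F} {1F} _ = ≡.refl
        rep-injective {1F} {2F} p = contradiction p a≁b
        rep-injective {2F} {0F} p = contradiction (ε∼⇒∈ (∼-sym p)) b∉M
        rep-injective {2F} {1F} p = contradiction (∼-sym p) a≁b
        rep-injective {2F} {2F} _ = ≡.refl

        open CosetAction isSubgroup rep (proj₁ ∘ covered) (proj₂ ∘ covered) rep-injective

        even : ∀ x → Even x
        even x = ∈-evens⁻ (no-index-2 evens-isSubgroup odd-∼ x)

    trivial-Φ⇒elementaryAbelian : (∀ {x} → Φ x → x ≈ ε) → IsElementaryAbelian 3
    trivial-Φ⇒elementaryAbelian Φ-trivial = record
      { comm    = λ x y → sym (begin
          y ∙ x                           ≈⟨ \\-leftDividesˡ (x ∙ y) (y ∙ x) ⟨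
          x ∙ y ∙ ((x ∙ y) ⁻¹ ∙ (y ∙ x))  ≈⟨ ∙-congˡ (Φ-trivial (λ M M-max →
                                              proj₂ (maximal⇒abelian-exponent-3-quotient M-max) x y)) ⟩
          x ∙ y ∙ ε                       ≈⟨ identityʳ _ ⟩
          x ∙ y                           ∎)
      ; order-p = λ x x≉ε → record
        { positive = s≤s z≤n
        ; power≈ε  = cube x
        ; least    = least x x≉ε
        }
      }
      where
      open SetoidReasoning setoid

      cube : ∀ x → power 3 x ≈ ε
      cube x = Φ-trivial (λ M M-max → proj₁ (maximal⇒abelian-exponent-3-quotient M-max) x)

      least : ∀ x → x ≉ ε → ∀ j → 0 < j → power j x ≈ ε → 3 ≤ j
      least x x≉ε 1 _ x¹≈ε = contradiction (trans (sym (identityʳ x)) x¹≈ε) x≉ε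
      -- Here `x = x ∙ x² = x³ = ε`.
      least x x≉ε 2 _ x²≈ε = contradiction
        (trans (sym (trans (∙-congˡ x²≈ε) (identityʳ x))) (cube x)) x≉ε
      least x x≉ε (ℕ.suc (ℕ.suc (ℕ.suc _))) _ _ = s≤s (s≤s (s≤s z≤n))

  -- Sum-free sets in elementary abelian 3-groups.

  module ElementaryAbelian3 (elementaryAbelian : IsElementaryAbelian 3) where

    open IsElementaryAbelian elementaryAbelian
    open MonoidMult monoid using (×-homo-+)

    commutativeMonoid : CommutativeMonoid c ℓ
    commutativeMonoid = record
      { isCommutativeMonoid = record { isMonoid = isMonoid ; comm = comm } }

    open CommutativeMonoidSolver commutativeMonoid using (solve; _⊜_; _⊕_)

    cube : ∀ x → x ∙ (x ∙ x) ≈ ε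
    cube x with x ≈? ε
    ... | yes x≈ε = trans (∙-cong x≈ε (∙-cong x≈ε x≈ε)) (trans (identityˡ _) (identityˡ ε))
    ... | no x≉ε  = trans (∙-congˡ (∙-congˡ (sym (identityʳ x)))) (HasOrder.power≈ε (order-p x x≉ε))

    -- Reduces an identity in the group to one in the free commutative monoid.
    modulo-cube : ∀ w {u v} → u ≈ v ∙ (w ∙ (w ∙ w)) → u ≈ v
    modulo-cube w eq = trans eq (trans (∙-congˡ (cube w)) (identityʳ _))

    x⁻¹≈x² : ∀ x → x ⁻¹ ≈ x ∙ x
    x⁻¹≈x² x = sym (inverseʳ-unique x (x ∙ x) (cube x))
      where open GroupProperties group using (inverseʳ-unique)

    xyy²≈x : ∀ x y → x ∙ y ∙ (y ∙ y) ≈ x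
    xyy²≈x x y = modulo-cube y (solve 2 (λ x y →
      ((x ⊕ y) ⊕ (y ⊕ y)) ⊜ (x ⊕ (y ⊕ (y ⊕ y)))) refl x y)

    xy²y≈x : ∀ x y → x ∙ (y ∙ y) ∙ y ≈ x
    xy²y≈x x y = modulo-cube y (solve 2 (λ x y →
      ((x ⊕ (y ⊕ y)) ⊕ y) ⊜ (x ⊕ (y ⊕ (y ⊕ y)))) refl x y)

    x²x²≈x : ∀ x → x ∙ x ∙ (x ∙ x) ≈ x
    x²x²≈x x = modulo-cube x (solve 1 (λ x →
      ((x ⊕ x) ⊕ (x ⊕ x)) ⊜ (x ⊕ (x ⊕ (x ⊕ x)))) refl x)

    -- The inverse of `x` is `x²`, a product.
    submonoid⇒subgroup : ∀ {H} → ε ∈ H → (∀ {x y} → x ∈ H → y ∈ H → x ∙ y ∈ H) → IsSubgroup H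
    submonoid⇒subgroup ε∈H ∙-closed = record
      { ε-closed  = ε∈H
      ; ∙-closed  = ∙-closed
      ; ⁻¹-closed = λ {x} x∈H → ∈-resp-≈ (sym (x⁻¹≈x² x)) (∙-closed x∈H x∈H)
      }

    -- Since `t³ = 1`, multiplication by `t` permutes `x`, `xt`, `xt²` cyclically, so of any two of
    -- them one is the other times `t`. As `t` lies in `T`, two of them in `T` would give a product
    -- in `T`.
    sumFree⇒disjoint : ∀ {T t} → IsSumFree T → t ∈ T → ∀ i → indicators T t i ≤ 1
    sumFree⇒disjoint {T} {t} T-sumFree t∈T i = indicators-≤1 T i _ _
      (λ (p , q) → sumFree (element-∈ p) t∈T q)
      (λ (p , r) → sumFree r t∈T (∈-resp-≈ (sym (xy²y≈x _ _)) (element-∈ p)))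
      (λ (q , r) → sumFree q t∈T (∈-resp-≈ (sym (assoc _ _ _)) r))
      where open IsSumFree T-sumFree using (sumFree)

    sumFree⇒3∣T∣≤size : ∀ {T} → IsSumFree T → 3 ℕ.* ∣ T ∣ ≤ size
    sumFree⇒3∣T∣≤size {T} T-sumFree with IsSumFree.nonempty T-sumFree
    ... | t , t∈T = ≡.subst₂ _≤_ (sum-indicators T t) (sum-one size)
      (sum-mono-≤ (sumFree⇒disjoint T-sumFree t∈T))

    -- A cover gives `size ≤ 3∣S∣`, and `3∣T∣ ≤ size` holds for every sum-free `T`.
    covers⇒largest : ∀ {S g} → Covers S g → ∀ T → IsSumFree T → ∣ T ∣ ≤ ∣ S ∣
    covers⇒largest cover T T-sumFree =
      ℕ.*-cancelˡ-≤ 3 (ℕ.≤-trans (sumFree⇒3∣T∣≤size T-sumFree) (covers⇒size≤3∣S∣ cover))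

    -- Equality case of the count: every summand is at most 1, so a point with summand 0 would push
    -- the sum `3∣S∣` below `size`.
    sumFree⇒covers : ∀ {S s} → IsSumFree S → size ≤ 3 ℕ.* ∣ S ∣ → s ∈ S → Covers S s
    sumFree⇒covers {S} {s} S-sumFree size≤ s∈S y
      with index y ∈? S | index (y ∙ s) ∈? S | index (y ∙ (s ∙ s)) ∈? S
    ... | yes p | _     | _     = inj₁ p
    ... | no _  | yes q | _     = inj₂ (inj₁ q)
    ... | no _  | no _  | yes r = inj₂ (inj₂ r)
    ... | no ¬p | no ¬q | no ¬r = contradiction size≤ (ℕ.<⇒≱ (≡.subst₂ _<_
      (sum-indicators S s) (sum-one size)
      (sum-mono-< (sumFree⇒disjoint S-sumFree s∈S) (index y) (s≤s none))))
      where
      none : indicators S s (index y) ≤ 0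
      none with index y ∈? S | index (element (index y) ∙ s) ∈? S
              | index (element (index y) ∙ (s ∙ s)) ∈? S
      ... | yes p | _     | _     = contradiction p ¬p
      ... | no _  | yes q | _     = contradiction (∈-resp-≈ (∙-congʳ (element-index y)) q) ¬q
      ... | no _  | no _  | yes r = contradiction (∈-resp-≈ (∙-congʳ (element-index y)) r) ¬r
      ... | no _  | no _  | no _  = z≤n

    -- The translations by `g` and `h` commute. This moves a cover between a subgroup and its
    -- cosets.
    covers-translate : ∀ {S g} h → Covers S g → Covers (translate S h) g
    covers-translate {S} {g} h cover y =
      Sum.map ∈-translate⁺ (Sum.map (move g) (move (g ∙ g))) (cover (y ∙ h))
      where
      move : ∀ k → y ∙ h ∙ k ∈ S → y ∙ k ∈ translate S h
      move k p = ∈-translate⁺ (∈-resp-≈ (solve 3 (λ y h k →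
        ((y ⊕ h) ⊕ k) ⊜ ((y ⊕ k) ⊕ h)) refl y h k) p)

    -- Subgroups of an elementary abelian 3-group.

    module _ {H} (isSubgroup : IsSubgroup H) where

      open IsSubgroup isSubgroup

      square-∉ : ∀ {x} → x ∉ H → x ∙ x ∉ H
      square-∉ {x} x∉H x²∈H = x∉H (∈-resp-≈ (x²x²≈x x) (∙-closed x²∈H x²∈H))

      cancelʳ-∈ : ∀ {x y} → x ∙ y ∈ H → y ∈ H → x ∈ H
      cancelʳ-∈ {x} {y} xy∈H y∈H = ∈-resp-≈ (xyy²≈x x y) (∙-closed xy∈H (∙-closed y∈H y∈H))

      -- A larger subgroup `K` has an element `k` outside `H`; the cover puts `kx` or `kx²` in `H`,
      -- so `K` contains `x` and with it all of `G`.
      covers⇒maximal : ∀ {x} → x ∉ H → Covers H x → IsMaximalSubgroup H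
      covers⇒maximal {x} x∉H cover = record
        { isSubgroup = isSubgroup
        ; proper     = λ H≡⊤ → x∉H (≡⊤⇒all-∈ H≡⊤ x)
        ; maximal    = maximal
        }
        where
        maximal : ∀ K → IsSubgroup K → H ⊂ K → K ≡ ⊤
        maximal K K-isSubgroup H⊂K with ⊂⇒∃∉ H⊂K
        ... | k , k∈K , k∉H = all-∈⇒≡⊤ all
          where
          module K = IsSubgroup K-isSubgroup

          cancelˡ-K : ∀ {y z} → y ∙ z ∈ K → y ∈ K → z ∈ K
          cancelˡ-K {y} {z} yz∈K y∈K = ∈-resp-≈
            (trans (solve 2 (λ y z → ((y ⊕ z) ⊕ (y ⊕ y)) ⊜ ((z ⊕ y) ⊕ (y ⊕ y))) refl y z) (xyy²≈x z y))
            (K.∙-closed yz∈K (K.∙-closed y∈K y∈K))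

          x∈K : x ∈ K
          x∈K with cover k
          ... | inj₁ k∈H         = contradiction k∈H k∉H
          ... | inj₂ (inj₁ kx∈H) = cancelˡ-K (⊂⇒⊆ H⊂K kx∈H) k∈K
          ... | inj₂ (inj₂ kx²∈H) = ∈-resp-≈ (x²x²≈x x) (K.∙-closed x²∈K x²∈K)
            where
            x²∈K : x ∙ x ∈ K
            x²∈K = cancelˡ-K (⊂⇒⊆ H⊂K kx²∈H) k∈K

          all : ∀ y → y ∈ K
          all y with cover y
          ... | inj₁ y∈H          = ⊂⇒⊆ H⊂K y∈H
          ... | inj₂ (inj₁ yx∈H)  = ∈-resp-≈ (xyy²≈x y x)
            (K.∙-closed (⊂⇒⊆ H⊂K yx∈H) (K.∙-closed x∈K x∈K))
          ... | inj₂ (inj₂ yx²∈H) = ∈-resp-≈ (xy²y≈x y x) (K.∙-closed (⊂⇒⊆ H⊂K yx²∈H) x∈K)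

      -- As `g³ = 1` and the group is abelian, `H g⁻² = H g = g H`.
      translate-isCoset : ∀ g → IsCoset g H (translate H (g ∙ g))
      translate-isCoset g x = mk⇔
        (λ x∈ → x ∙ (g ∙ g) , ∈-translate⁻ x∈ , sym (trans (comm _ _) (xy²y≈x x g)))
        (λ { (h , h∈H , x≈gh) → ∈-translate⁺ (∈-resp-≈
          (sym (trans (∙-congʳ (trans x≈gh (comm g h))) (xyy²≈x h g))) h∈H) })

      translate-isSumFree : ∀ {g} → g ∉ H → IsSumFree (translate H (g ∙ g))
      translate-isSumFree {g} g∉H = record
        { nonempty = g , ∈-translate⁺ (∈-resp-≈ (sym (cube g)) ε-closed)
        -- The product of `xg²` and `yg²` is `g²` times `xyg²`; with `xg²`, `yg²` and `xyg²` in `H`,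
        -- also `g²` would lie in `H`.
        ; sumFree  = λ {x} {y} x∈ y∈ xy∈ → square-∉ g∉H (cancelʳ-∈
            (∈-resp-≈ (product x y) (∙-closed (∈-translate⁻ x∈) (∈-translate⁻ y∈)))
            (∈-translate⁻ xy∈))
        }
        where
        product : ∀ x y → x ∙ (g ∙ g) ∙ (y ∙ (g ∙ g)) ≈ g ∙ g ∙ (x ∙ y ∙ (g ∙ g))
        product x y = solve 3 (λ x y g →
          ((x ⊕ (g ⊕ g)) ⊕ (y ⊕ (g ⊕ g))) ⊜ ((g ⊕ g) ⊕ ((x ⊕ y) ⊕ (g ⊕ g)))) refl x y g

      adjoined? : ∀ g → Decidable (Adjoined H g)
      adjoined? g x = index x ∈? H ⊎-dec index (x ∙ g) ∈? H ⊎-dec index (x ∙ (g ∙ g)) ∈? H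

      adjoined-resp-≈ : ∀ g {x y} → x ≈ y → Adjoined H g x → Adjoined H g y
      adjoined-resp-≈ g x≈y = Sum.map (∈-resp-≈ x≈y)
        (Sum.map (∈-resp-≈ (∙-congʳ x≈y)) (∈-resp-≈ (∙-congʳ x≈y)))

      adjoin : Carrier → SubsetOf
      adjoin g = comprehension (adjoined? g)

      ∈-adjoin⁺ : ∀ {g x} → Adjoined H g x → x ∈ adjoin g
      ∈-adjoin⁺ {g} = ∈-comprehension⁺ (adjoined? g) (adjoined-resp-≈ g)

      ∈-adjoin⁻ : ∀ {g x} → x ∈ adjoin g → Adjoined H g x
      ∈-adjoin⁻ {g} = ∈-comprehension⁻ (adjoined? g) (adjoined-resp-≈ g)

      -- Reduces exponents modulo 3. With arbitrary exponents, `adjoined-∙` just adds them instead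
      -- of treating nine cases.
      power⇒adjoined : ∀ {g x} k → x ∙ power k g ∈ H → Adjoined H g x
      power⇒adjoined 0 p = inj₁ (∈-resp-≈ (identityʳ _) p)
      power⇒adjoined 1 p = inj₂ (inj₁ (∈-resp-≈ (∙-congˡ (identityʳ _)) p))
      power⇒adjoined 2 p = inj₂ (inj₂ (∈-resp-≈ (∙-congˡ (∙-congˡ (identityʳ _))) p))
      power⇒adjoined {g} {x} (ℕ.suc (ℕ.suc (ℕ.suc k))) p = power⇒adjoined k
        (∈-resp-≈ (modulo-cube g (solve 3 (λ x g q →
          (x ⊕ (g ⊕ (g ⊕ (g ⊕ q)))) ⊜ ((x ⊕ q) ⊕ (g ⊕ (g ⊕ g)))) refl x g (power k g))) p)

      adjoined⇒power : ∀ {g x} → Adjoined H g x → ∃ λ k → x ∙ power k g ∈ H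
      adjoined⇒power (inj₁ p)        = 0 , ∈-resp-≈ (sym (identityʳ _)) p
      adjoined⇒power (inj₂ (inj₁ p)) = 1 , ∈-resp-≈ (∙-congˡ (sym (identityʳ _))) p
      adjoined⇒power (inj₂ (inj₂ p)) = 2 , ∈-resp-≈ (∙-congˡ (∙-congˡ (sym (identityʳ _)))) p

      adjoined-∙ : ∀ {g x y} → Adjoined H g x → Adjoined H g y → Adjoined H g (x ∙ y)
      adjoined-∙ {g} {x} {y} p q with adjoined⇒power p | adjoined⇒power q
      ... | k , p′ | l , q′ = power⇒adjoined (k ℕ.+ l) (∈-resp-≈
        (trans (solve 4 (λ x y u v → ((x ⊕ u) ⊕ (y ⊕ v)) ⊜ ((x ⊕ y) ⊕ (u ⊕ v))) refl x y _ _)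
          (∙-congˡ (sym (×-homo-+ g k l))))
        (∙-closed p′ q′))

      ⊆-adjoin : ∀ {g x} → x ∈ H → x ∈ adjoin g
      ⊆-adjoin = ∈-adjoin⁺ ∘ inj₁

      g∈adjoin : ∀ {g} → g ∈ adjoin g
      g∈adjoin {g} = ∈-adjoin⁺ (inj₂ (inj₂ (∈-resp-≈ (sym (cube g)) ε-closed)))

      adjoin-isSubgroup : ∀ g → IsSubgroup (adjoin g)
      adjoin-isSubgroup g = submonoid⇒subgroup (⊆-adjoin ε-closed)
        (λ p q → ∈-adjoin⁺ (adjoined-∙ (∈-adjoin⁻ p) (∈-adjoin⁻ q)))

    -- The subgroup generated by `M` and `x` properly contains `M`, hence is everything.
    maximal⇒covers : ∀ {M x} → IsMaximalSubgroup M → x ∉ M → Covers M x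
    maximal⇒covers {M} {x} M-max x∉M y = ∈-adjoin⁻ isSubgroup (≡⊤⇒all-∈
      (maximal (adjoin isSubgroup x) (adjoin-isSubgroup isSubgroup x)
        (∉⇒⊂ (⊆-adjoin isSubgroup) (g∈adjoin isSubgroup) x∉M)) y)
      where open IsMaximalSubgroup M-max

    -- A subgroup maximal among those avoiding x is a complement of ⟨ x ⟩.
    extend-avoiding : ∀ {x} H → Acc _⊃_ H → IsSubgroup H → x ∉ H →
                      ∃ λ M → IsMaximalSubgroup M × x ∉ M
    extend-avoiding {x} H (acc rec) isSubgroup x∉H
      with any? (λ i → ¬? (index (element i) ∈? H)
                 ×-dec ¬? (index x ∈? adjoin isSubgroup (element i)))
    -- Some extension of `H` by one element still avoids `x`; it is strictly larger, so recursion
    -- along `⊃` terminates.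
    ... | yes (i , i∉H , x∉) = extend-avoiding (adjoin isSubgroup (element i))
      (rec (∉⇒⊂ (⊆-adjoin isSubgroup) (g∈adjoin isSubgroup) i∉H))
      (adjoin-isSubgroup isSubgroup (element i)) x∉
    -- Now `x` lies in `H⟨y⟩` for all `y` outside `H`, so by exchange `y` lies in `H⟨x⟩`.
    ... | no none = H , covers⇒maximal isSubgroup x∉H cover , x∉H
      where
      open IsSubgroup isSubgroup

      x∈adjoin : ∀ {y} → y ∉ H → x ∈ adjoin isSubgroup (element (index y))
      x∈adjoin {y} y∉H with index x ∈? adjoin isSubgroup (element (index y))
      ... | yes x∈ = x∈
      ... | no x∉  = contradiction (index y , y∉H ∘ ∈-resp-≈ (element-index y) , x∉) none

      cover : Covers H x
      cover y with index y ∈? H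
      ... | yes y∈H = inj₁ y∈H
      ... | no y∉H with ∈-adjoin⁻ isSubgroup (x∈adjoin y∉H)
      ... | inj₁ x∈H = contradiction x∈H x∉H
      ... | inj₂ (inj₁ xy∈H) =
        inj₂ (inj₁ (∈-resp-≈ (trans (∙-congˡ (element-index y)) (comm x y)) xy∈H))
      -- Squaring `xy²` gives `yx² ∙ y³ = yx²`.
      ... | inj₂ (inj₂ xy²∈H) = inj₂ (inj₂ (∈-resp-≈
        (trans (∙-cong (∙-congˡ y²) (∙-congˡ y²)) (modulo-cube y (solve 2 (λ x y →
          ((x ⊕ (y ⊕ y)) ⊕ (x ⊕ (y ⊕ y))) ⊜ ((y ⊕ (x ⊕ x)) ⊕ (y ⊕ (y ⊕ y)))) refl x y)))
        (∙-closed xy²∈H xy²∈H)))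
        where
        y² = ∙-cong (element-index y) (element-index y)

    -- The extension starts from the trivial subgroup, which avoids `x`.
    avoiding-maximal : ∀ {x} → x ≉ ε → ∃ λ M → IsMaximalSubgroup M × x ∉ M
    avoiding-maximal x≉ε = extend-avoiding (comprehension (_≈? ε)) (⊃-wellFounded _)
      (submonoid⇒subgroup (∈-trivial⁺ refl)
        (λ p q → ∈-trivial⁺ (trans (∙-cong (∈-trivial⁻ p) (∈-trivial⁻ q)) (identityˡ ε))))
      (x≉ε ∘ ∈-trivial⁻)
      where
      resp : ∀ {x y} → x ≈ y → x ≈ ε → y ≈ ε
      resp x≈y x≈ε = trans (sym x≈y) x≈ε

      ∈-trivial⁺ : ∀ {x} → x ≈ ε → x ∈ comprehension (_≈? ε)
      ∈-trivial⁺ = ∈-comprehension⁺ (_≈? ε) resp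

      ∈-trivial⁻ : ∀ {x} → x ∈ comprehension (_≈? ε) → x ≈ ε
      ∈-trivial⁻ = ∈-comprehension⁻ (_≈? ε) resp

    Φ-trivial : ∀ {x} → Φ x → x ≈ ε
    Φ-trivial {x} x∈Φ with x ≈? ε
    ... | yes x≈ε = x≈ε
    ... | no x≉ε with avoiding-maximal x≉ε
    ... | M , M-max , x∉M = contradiction (x∈Φ M M-max) x∉M

    -- The two non-trivial cosets of a maximal subgroup.

    module _ {M x} (M-max : IsMaximalSubgroup M) (x∉M : x ∉ M) where

      open IsMaximalSubgroup M-max using (isSubgroup)
      open LeftCosets isSubgroup

      translate-isMaximalSumFree : IsMaximalSumFree (translate M (x ∙ x))
      translate-isMaximalSumFree = record
        { isSumFree = translate-isSumFree isSubgroup x∉M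
        ; largest   = covers⇒largest (covers-translate (x ∙ x) (maximal⇒covers M-max x∉M))
        }

      x≁x² : ¬ x ∼ (x ∙ x)
      x≁x² = x∉M ∘ ∈-resp-≈ (\\-leftDividesʳ x x)

      -- The cover puts `gx` or `gx²` in `M`, and these are `x⁻²g` and `x⁻¹g`.
      classes : ∀ {g} → g ∉ M → x ∼ g ⊎ (x ∙ x) ∼ g
      classes {g} g∉M = Sum.[ (λ g∈M → contradiction g∈M g∉M) ,
        Sum.[ inj₂ ∘ ∈-resp-≈ gx≈x⁻²g , inj₁ ∘ ∈-resp-≈ gx²≈x⁻¹g ]′ ]′ (maximal⇒covers M-max x∉M g)
        where
        gx≈x⁻²g : g ∙ x ≈ (x ∙ x) ⁻¹ ∙ g
        gx≈x⁻²g = trans (comm g x) (∙-congʳ (sym (trans (x⁻¹≈x² (x ∙ x)) (x²x²≈x x))))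

        gx²≈x⁻¹g : g ∙ (x ∙ x) ≈ x ⁻¹ ∙ g
        gx²≈x⁻¹g = trans (comm g (x ∙ x)) (∙-congʳ (sym (x⁻¹≈x² x)))

    maximal⇒two-cosets : ∀ M → IsMaximalSubgroup M →
      ∃₂ λ A B → A ≢ B
               × (∀ S → IsNonTrivialCoset M S ⇔ (S ≡ A ⊎ S ≡ B))
               × IsMaximalSumFree A
               × IsMaximalSumFree B
    maximal⇒two-cosets M M-max with ≢⊤⇒∃∉ (IsMaximalSubgroup.proper M-max)
    ... | x , x∉M = A , B , A≢B , (λ S → mk⇔ (to S) (from S)) ,
      translate-isMaximalSumFree M-max x∉M , translate-isMaximalSumFree M-max x²∉M
      where
      open IsMaximalSubgroup M-max using (isSubgroup)
      open LeftCosets isSubgroup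

      x²∉M : x ∙ x ∉ M
      x²∉M = square-∉ isSubgroup x∉M

      A B : SubsetOf
      -- `translate M (g ∙ g)` is the coset `gM`; here `g` is `x` for `A` and `x²` for `B`.
      A = translate M (x ∙ x)
      B = translate M (x ∙ x ∙ (x ∙ x))

      A-isCoset : IsCoset x M A
      A-isCoset = translate-isCoset isSubgroup x

      B-isCoset : IsCoset (x ∙ x) M B
      B-isCoset = translate-isCoset isSubgroup (x ∙ x)

      A≢B : A ≢ B
      A≢B A≡B = x≁x² M-max x∉M (∼-sym (coset⁻ B-isCoset
        (≡.subst (x ∈_) A≡B (coset⁺ A-isCoset (∼-reflexive refl)))))

      to : ∀ S → IsNonTrivialCoset M S → S ≡ A ⊎ S ≡ B
      to S (g , g∉M , S-isCoset) = Sum.map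
        (≡.sym ∘ coset-unique A-isCoset S-isCoset)
        (≡.sym ∘ coset-unique B-isCoset S-isCoset) (classes M-max x∉M g∉M)

      from : ∀ S → S ≡ A ⊎ S ≡ B → IsNonTrivialCoset M S
      from S (inj₁ ≡.refl) = x , x∉M , A-isCoset
      from S (inj₂ ≡.refl) = x ∙ x , x²∉M , B-isCoset

    -- Maximal sum-free sets as cosets.

    module _ {S s} (S-max : IsMaximalSumFree S) (s∈S : s ∈ S) where

      open IsMaximalSumFree S-max
      open IsSumFree isSumFree using (sumFree)

      s≉ε : s ≉ ε
      s≉ε s≈ε = sumFree s∈S s∈S (∈-resp-≈ (sym (trans (∙-congʳ s≈ε) (identityˡ s))) s∈S)

      -- For a maximal subgroup `N` avoiding `s`, the coset `sN` is sum-free and has at least a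
      -- third of all elements; `S` is at least as large.
      size≤ : size ≤ 3 ℕ.* ∣ S ∣
      size≤ = let N , N-max , s∉N = avoiding-maximal s≉ε in ℕ.≤-trans
        (covers⇒size≤3∣S∣ (covers-translate (s ∙ s) (maximal⇒covers N-max s∉N)))
        (ℕ.*-monoʳ-≤ 3 (largest (translate N (s ∙ s))
          (translate-isSumFree (IsMaximalSubgroup.isSubgroup N-max) s∉N)))

      covers : ∀ {t} → t ∈ S → Covers S t
      covers = sumFree⇒covers isSumFree size≤

      -- S is closed under taking the third point u⁻¹t⁻¹ of the affine line through t and u:
      -- the coset t⁻¹⟨ u ⟩ meets S, but neither in t⁻¹ nor in t⁻¹u.
      third-point : ∀ {t u} → t ∈ S → u ∈ S → t ∙ t ∙ (u ∙ u) ∈ S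
      third-point {t} {u} t∈S u∈S = Sum.[ (λ t²∈S → contradiction t²∈S (sumFree t∈S t∈S)) ,
        Sum.[ (λ t²u∈S → contradiction u∈S (sumFree t∈S t²u∈S ∘ ∈-resp-≈ u≈tt²u)) , id ]′ ]′
        (covers u∈S (t ∙ t))
        where
        u≈tt²u : u ≈ t ∙ (t ∙ t ∙ u)
        u≈tt²u = sym (modulo-cube t (solve 2 (λ t u →
          (t ⊕ ((t ⊕ t) ⊕ u)) ⊜ (u ⊕ (t ⊕ (t ⊕ t)))) refl t u))

      s∉M : s ∉ translate S s
      s∉M s∈M = sumFree s∈S s∈S (∈-translate⁻ s∈M)

      -- `translate S s` is `s⁻¹S`, the direction of the affine subspace `S`. For `xs` and `ys` in
      -- `S` the third point is `(xy)²s`, and the third point of that with `s` is `xys`.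
      M-isSubgroup : IsSubgroup (translate S s)
      M-isSubgroup = submonoid⇒subgroup (∈-translate⁺ (∈-resp-≈ (sym (identityˡ s)) s∈S))
        (λ {x} {y} x∈M y∈M → ∈-translate⁺ (∈-resp-≈ (reflect (x ∙ y)) (third-point
          (∈-resp-≈ (product x y) (third-point (∈-translate⁻ x∈M) (∈-translate⁻ y∈M))) s∈S)))
        where
        product : ∀ x y → x ∙ s ∙ (x ∙ s) ∙ (y ∙ s ∙ (y ∙ s)) ≈ x ∙ y ∙ (x ∙ y) ∙ s
        product x y = modulo-cube s (solve 3 (λ x y s →
          (((x ⊕ s) ⊕ (x ⊕ s)) ⊕ ((y ⊕ s) ⊕ (y ⊕ s)))
            ⊜ ((((x ⊕ y) ⊕ (x ⊕ y)) ⊕ s) ⊕ (s ⊕ (s ⊕ s)))) refl x y s)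

        reflect : ∀ z → z ∙ z ∙ s ∙ (z ∙ z ∙ s) ∙ (s ∙ s) ≈ z ∙ s
        reflect z = modulo-cube (z ∙ s) (solve 2 (λ z s →
          ((((z ⊕ z) ⊕ s) ⊕ ((z ⊕ z) ⊕ s)) ⊕ (s ⊕ s))
            ⊜ ((z ⊕ s) ⊕ ((z ⊕ s) ⊕ ((z ⊕ s) ⊕ (z ⊕ s))))) refl z s)

      coset : IsCoset s (translate S s) S
      coset x = mk⇔
        (λ x∈S → x ∙ (s ∙ s) , ∈-translate⁺ (∈-resp-≈ (sym (xy²y≈x x s)) x∈S) ,
          sym (trans (comm s (x ∙ (s ∙ s))) (xy²y≈x x s)))
        (λ { (h , h∈M , x≈sh) →
          ∈-resp-≈ (trans (comm h s) (sym x≈sh)) (∈-translate⁻ h∈M) })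

    -- For any `s` in `S`, the subgroup `s⁻¹S` has `S` as its coset of `s`; the cover of `G` from
    -- the equality case, translated by `s`, makes this subgroup maximal.
    maximalSumFree⇒coset : ∀ S → IsMaximalSumFree S →
      ∃ λ M → IsMaximalSubgroup M × IsNonTrivialCoset M S
    maximalSumFree⇒coset S S-max with IsSumFree.nonempty (IsMaximalSumFree.isSumFree S-max)
    ... | s , s∈S = translate S s ,
      covers⇒maximal (M-isSubgroup S-max s∈S) (s∉M S-max s∈S)
        (covers-translate s (covers S-max s∈S s∈S)) ,
      s , s∉M S-max s∈S , coset S-max s∈S

    Φ≐ε : Φ ≐ (_≈ ε)
    Φ≐ε = Φ-trivial , λ x≈ε M M-max → ∈-resp-≈ (sym x≈ε)
      (IsSubgroup.ε-closed (IsMaximalSubgroup.isSubgroup M-max))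

theorem1 : ∀ {c ℓ} (G : FiniteGroup c ℓ) →
  let open FiniteGroup G
      open FiniteGroupTheory G
  in
  IsElementaryAbelian 3 ⇔
    ( (∀ M → IsMaximalSubgroup M →
         ∃₂ λ A B → A ≢ B
                  × (∀ S → IsNonTrivialCoset M S ⇔ (S ≡ A ⊎ S ≡ B))
                  × IsMaximalSumFree A
                  × IsMaximalSumFree B)
    × (∀ S → IsMaximalSumFree S →
         ∃ λ M → IsMaximalSubgroup M × IsNonTrivialCoset M S)
    × Φ ≐ (_≈ ε) )
theorem1 G = mk⇔
  (λ elementaryAbelian → let open ElementaryAbelian3 elementaryAbelian in
    maximal⇒two-cosets , maximalSumFree⇒coset , Φ≐ε)
  (λ (cosets , _ , Φ⊆ε , _) → Converse.trivial-Φ⇒elementaryAbelian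
    (λ M M-max → let (A , B , A≢B , exactly , _) = cosets M M-max in A , B , A≢B , exactly)
    Φ⊆ε)
  where open FiniteGroupProperties G
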